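{- Let $n,d$ be integers with $d>1$ and $n>d$, and let $L_{n,d}$ be the lollipop network of order $n$. Then the agglomeration of $L_{n,d}$ is $$\phi(L_{n,d})=\frac{3(n-1)}{3(n-d)(d^2-1+n)+d(d^2-1)}.$$
   Context: All graphs are finite, simple and undirected. The order of a graph is its number of nodes; $d_{uv}$ denotes the length of a shortest path between nodes $u$ and $v$. For a connected graph $H$ of order $m\ge 2$, the agglomeration is $$\phi(H)=\frac{m-1}{\sum_{u,v\in V(H),\,u\ne v} d_{uv}},$$ where the sum is over all ordered pairs $(u,v)$ of distinct nodes (equivalently $\phi(H)=1/(mL(H))$, where $L(H)=\frac{1}{m(m-1)}\sum_{u\neq v}d_{uv}$ is the average path length). The lollipop network $L_{n,d}$ is the graph of order $n$ obtained from a complete graph $K_{n-d}$ and a path $P_d$ of order $d$ $(d>1)$ by joining one of the end-nodes of $P_d$ to all the nodes of $K_{n-d}$. -}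

module Defs where

open import Data.Empty using (⊥-elim)
open import Data.Fin using (Fin; zero; suc; toℕ; cast; inject₁; splitAt; join)
open import Data.Fin.Properties using
  (_≟_; any?; toℕ-cast; toℕ-inject₁; toℕ-injective; splitAt-join; join-splitAt)
open import Data.Integer using (+_)
open import Data.List using (List; allFin; cartesianProduct; filter; map)
open import Data.List.Membership.Propositional using (_∈_)
open import Data.List.Membership.Propositional.Properties using
  (∈-allFin; ∈-cartesianProduct⁺; ∈-filter⁺; ∈-map⁺)
open import Data.List.Relation.Unary.Any using (here; there)
open import Data.Nat using
  (ℕ; zero; suc; _+_; _*_; _∸_; _^_; _≤_; _<_; _>_; z≤n; s≤s; NonZero; >-nonZero)
open import Data.Nat.ListAction using (sum)
open import Data.Nat.Properties using
  (m≤m+n; m≤n+m; m≤n*m; ≤-trans; <-≤-trans; m∸n+n≡m;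
   m<n⇒0<n∸m; *-mono-≤; suc-injective; 1+n≢n)
  renaming (_≟_ to _≟ℕ_)
open import Data.Product using (∃; _×_; _,_; proj₁; uncurry)
open import Data.Rational using (ℚ; _/_)
open import Data.Sum using (_⊎_; inj₁; inj₂; swap)
open import Data.Vec using (Vec; []; _∷_; head; last)
open import Data.Vec.Membership.DecPropositional using (_∈?_)
import Data.Vec.Membership.Propositional as Vecᵐ
open import Data.Vec.Relation.Unary.AllPairs using (allPairs?; []; _∷_)
open import Data.Vec.Relation.Unary.All using (All; []; _∷_)
import Data.Vec.Relation.Unary.Any as Vecᵃ
open import Data.Vec.Relation.Unary.Linked using (Linked; linked?; [-]; _∷_)
open import Data.Vec.Relation.Unary.Unique.Propositional using (Unique)
open import Level using (0ℓ)
open import Relation.Binary using (Rel; Symmetric; Irreflexive)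
import Relation.Binary as B
open import Relation.Binary.Construct.Closure.ReflexiveTransitive using
  (Star; ε; _◅_; _◅◅_; reverse)
open import Relation.Binary.PropositionalEquality using
  (_≡_; _≢_; refl; sym; trans; cong; subst; subst₂)
open import Relation.Nullary using (Dec; yes; no; ¬_; ¬?)
open import Relation.Nullary.Decidable using (map′; _×-dec_; _⊎-dec_)
open import Relation.Unary using (Pred; Decidable)

-- A finite simple graph of order n.  Decidability of adjacency is automatic
-- classically; here it is what makes distances computable.

record Graph (n : ℕ) : Set₁ where
  field
    Adj    : Rel (Fin n) 0ℓ
    adj?   : B.Decidable Adj
    symm   : Symmetric Adj
    irrefl : Irreflexive _≡_ Adj

open Graph

-- The sequence of nodes of a path with k edges; nodes may not repeat.

record IsPath {n} (G : Graph n) (u v : Fin n) {k} (ws : Vec (Fin n) (suc k)) : Set where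
  constructor mkPath
  field
    starts : head ws ≡ u
    ends   : last ws ≡ v
    linked : Linked (Adj G) ws
    unique : Unique ws

PathOfLength : ∀ {n} → Graph n → Fin n → Fin n → ℕ → Set
PathOfLength {n} G u v k = ∃ λ (ws : Vec (Fin n) (suc k)) → IsPath G u v ws

Connected : ∀ {n} → Graph n → Set
Connected G = ∀ u v → ∃ (PathOfLength G u v)

isPath? : ∀ {n} (G : Graph n) u v {k} (ws : Vec (Fin n) (suc k)) → Dec (IsPath G u v ws)
isPath? G u v ws =
  map′ (λ { (s , e , l , q) → mkPath s e l q }) (λ { (mkPath s e l q) → s , e , l , q })
    (head ws ≟ u ×-dec last ws ≟ v ×-dec linked? (adj? G) ws
      ×-dec allPairs? (λ x y → ¬? (x ≟ y)) ws)

anyVec? : ∀ {n k} {P : Pred (Vec (Fin n) k) 0ℓ} → Decidable P → Dec (∃ P)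
anyVec? {k = zero}  P? = map′ ([] ,_) (λ { ([] , p) → p }) (P? [])
anyVec? {k = suc k} P? =
  map′ (λ { (x , xs , p) → x ∷ xs , p }) (λ { (x ∷ xs , p) → x , xs , p })
    (any? λ x → anyVec? λ xs → P? (x ∷ xs))

pathOfLength? : ∀ {n} (G : Graph n) u v → Decidable (PathOfLength G u v)
pathOfLength? G u v k = anyVec? (isPath? G u v)

IsLeast : Pred ℕ 0ℓ → Pred ℕ 0ℓ
IsLeast P k = P k × (∀ j → P j → k ≤ j)

least : {P : Pred ℕ 0ℓ} → Decidable P → ∀ k → P k → ∃ (IsLeast P)
least P? zero    p = 0 , p , λ _ _ → z≤n
least P? (suc k) p with P? 0
... | yes p₀ = 0 , p₀ , λ _ _ → z≤n
... | no ¬p₀ with j , pⱼ , min ← least (λ i → P? (suc i)) k p =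
  suc j , pⱼ , λ { zero q → ⊥-elim (¬p₀ q) ; (suc i) q → s≤s (min i q) }

shortest : ∀ {n} (G : Graph n) → Connected G → ∀ u v → ∃ (IsLeast (PathOfLength G u v))
shortest G c u v = uncurry (least (pathOfLength? G u v)) (c u v)

dist : ∀ {n} (G : Graph n) → Connected G → Fin n → Fin n → ℕ
dist G c u v = proj₁ (shortest G c u v)

distinctPairs : ∀ n → List (Fin n × Fin n)
distinctPairs n =
  filter (λ (u , v) → ¬? (u ≟ v)) (cartesianProduct (allFin n) (allFin n))

distanceSum : ∀ {n} (G : Graph n) → Connected G → ℕ
distanceSum {n} G c = sum (map (uncurry (dist G c)) (distinctPairs n))

∈⇒≤sum : ∀ {x xs} → x ∈ xs → x ≤ sum xs
∈⇒≤sum (here refl)      = m≤m+n _ _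
∈⇒≤sum (there {x = y} p) = ≤-trans (∈⇒≤sum p) (m≤n+m _ y)

dist>0 : ∀ {n} (G : Graph n) (c : Connected G) {u v} → u ≢ v → dist G c u v > 0
dist>0 G c {u} {v} u≢v with shortest G c u v
... | zero  , (_ ∷ [] , mkPath s e _ _) , _ = ⊥-elim (u≢v (trans (sym s) e))
... | suc _ , _ = s≤s z≤n

distanceSum≢0 : ∀ {n} (G : Graph n) (c : Connected G) → 2 ≤ n → NonZero (distanceSum G c)
distanceSum≢0 {suc (suc n)} G c _ = >-nonZero
  (<-≤-trans (dist>0 G c {zero} {suc zero} λ ())
    (∈⇒≤sum (∈-map⁺ (uncurry (dist G c))
      (∈-filter⁺ (λ (u , v) → ¬? (u ≟ v))
        (∈-cartesianProduct⁺ (∈-allFin zero) (∈-allFin (suc zero))) λ ()))))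
distanceSum≢0 {suc zero} G c (s≤s ())

agglomeration : ∀ {n} (G : Graph n) → Connected G → 2 ≤ n → ℚ
agglomeration {n} G c 2≤n = (+ (n ∸ 1)) / distanceSum G c
  where instance _ = distanceSum≢0 G c 2≤n

complete : ∀ n → Graph n
complete n = record
  { Adj    = _≢_
  ; adj?   = λ u v → ¬? (u ≟ v)
  ; symm   = λ u≢v v≡u → u≢v (sym v≡u)
  ; irrefl = λ u≡v u≢v → u≢v u≡v
  }

path : ∀ n → Graph n
path n = record
  { Adj    = λ u v → toℕ v ≡ suc (toℕ u) ⊎ toℕ u ≡ suc (toℕ v)
  ; adj?   = λ u v → (toℕ v ≟ℕ suc (toℕ u)) ⊎-dec (toℕ u ≟ℕ suc (toℕ v))
  ; symm   = swap
  ; irrefl = λ { refl (inj₁ p) → 1+n≢n (sym p) ; refl (inj₂ p) → 1+n≢n (sym p) }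
  }

-- Path node 0 is the end-node joined to every node of the complete graph.

module Lollipop (a d : ℕ) where

  JoinAdj : Rel (Fin a ⊎ Fin d) 0ℓ
  JoinAdj (inj₁ i) (inj₁ j) = Adj (complete a) i j
  JoinAdj (inj₁ _) (inj₂ j) = toℕ j ≡ 0
  JoinAdj (inj₂ i) (inj₁ _) = toℕ i ≡ 0
  JoinAdj (inj₂ i) (inj₂ j) = Adj (path d) i j

  joinAdj? : B.Decidable JoinAdj
  joinAdj? (inj₁ i) (inj₁ j) = adj? (complete a) i j
  joinAdj? (inj₁ _) (inj₂ j) = toℕ j ≟ℕ 0
  joinAdj? (inj₂ i) (inj₁ _) = toℕ i ≟ℕ 0
  joinAdj? (inj₂ i) (inj₂ j) = adj? (path d) i j

  joinAdj-sym : Symmetric JoinAdj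
  joinAdj-sym {inj₁ _} {inj₁ _} = symm (complete a)
  joinAdj-sym {inj₁ _} {inj₂ _} p = p
  joinAdj-sym {inj₂ _} {inj₁ _} p = p
  joinAdj-sym {inj₂ _} {inj₂ _} = symm (path d)

  joinAdj-irrefl : Irreflexive _≡_ JoinAdj
  joinAdj-irrefl {inj₁ _} refl = irrefl (complete a) refl
  joinAdj-irrefl {inj₂ _} refl = irrefl (path d) refl

-- The first n ∸ d nodes are those of the complete graph, the remaining d those
-- of the path.

side : ∀ {n d} → d ≤ n → Fin n → Fin (n ∸ d) ⊎ Fin d
side {n} {d} d≤n v = splitAt (n ∸ d) (cast (sym (m∸n+n≡m d≤n)) v)

lollipop : ∀ n d → d ≤ n → Graph n
lollipop n d d≤n = record
  { Adj    = λ u v → JoinAdj (side d≤n u) (side d≤n v)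
  ; adj?   = λ u v → joinAdj? (side d≤n u) (side d≤n v)
  ; symm   = λ {u} {v} → joinAdj-sym {side d≤n u} {side d≤n v}
  ; irrefl = λ { {u} refl → joinAdj-irrefl {side d≤n u} refl }
  } where open Lollipop (n ∸ d) d

dropToNode : ∀ {n} (G : Graph n) {x u v k} {ws : Vec (Fin n) (suc k)} →
             IsPath G u v ws → x Vecᵐ.∈ ws → ∃ (PathOfLength G x v)
dropToNode G {ws = _ ∷ _} (mkPath _ e l q) (Vecᵃ.here refl) = _ , _ , mkPath refl e l q
dropToNode G {ws = _ ∷ _ ∷ _} (mkPath _ e (_ ∷ l) (_ ∷ q)) (Vecᵃ.there p) =
  dropToNode G (mkPath refl e l q) p

∉⇒All≢ : ∀ {n k} {u : Fin n} {ws : Vec (Fin n) k} → ¬ (u Vecᵐ.∈ ws) → All (u ≢_) ws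
∉⇒All≢ {ws = []}     _  = []
∉⇒All≢ {ws = _ ∷ _} u∉ = (λ eq → u∉ (Vecᵃ.here eq)) ∷ ∉⇒All≢ (λ p → u∉ (Vecᵃ.there p))

walk⇒path : ∀ {n} (G : Graph n) {u v} → Star (Adj G) u v → ∃ (PathOfLength G u v)
walk⇒path G {u} ε = 0 , u ∷ [] , mkPath refl refl [-] ([] ∷ [])
walk⇒path G {u} (a ◅ as) with walk⇒path G as
... | k , w ∷ ws , p@(mkPath refl e l q) with _∈?_ _≟_ u (w ∷ ws)
... | yes u∈ws = dropToNode G p u∈ws
... | no  u∉ws = suc k , u ∷ w ∷ ws , mkPath refl e (a ∷ l) (∉⇒All≢ u∉ws ∷ q)

lollipop-connected : ∀ n d (1<d : 1 < d) (d≤n : d ≤ n) → Connected (lollipop n d d≤n)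
lollipop-connected n d@(suc d-1) 1<d d≤n u v =
  walk⇒path L (toEnd (side d≤n u) u refl
    ◅◅ reverse (λ {x} {y} → symm L {x} {y}) (toEnd (side d≤n v) v refl))
  where
  L = lollipop n d d≤n
  open Lollipop (n ∸ d) d

  node : Fin (n ∸ d) ⊎ Fin d → Fin n
  node s = cast (m∸n+n≡m d≤n) (join (n ∸ d) d s)

  side-node : ∀ s → side d≤n (node s) ≡ s
  side-node s = trans
    (cong (splitAt (n ∸ d)) (toℕ-injective (trans (toℕ-cast _ (node s)) (toℕ-cast _ (join (n ∸ d) d s)))))
    (splitAt-join (n ∸ d) d s)

  node-side : ∀ v → node (side d≤n v) ≡ v
  node-side v = toℕ-injective (trans (toℕ-cast _ (join (n ∸ d) d (side d≤n v)))
    (trans (cong toℕ (join-splitAt (n ∸ d) d (cast (sym (m∸n+n≡m d≤n)) v))) (toℕ-cast _ v)))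

  edge : ∀ {s t} → JoinAdj s t → Adj L (node s) (node t)
  edge {s} {t} = subst₂ JoinAdj (sym (side-node s)) (sym (side-node t))

  end : Fin n
  end = node (inj₂ zero)

  pathToEnd : ∀ k (j : Fin d) → toℕ j ≡ k → Star (Adj L) (node (inj₂ j)) end
  pathToEnd _ zero _ = ε
  pathToEnd (suc k) (suc j) eq =
    edge {inj₂ (suc j)} {inj₂ (inject₁ j)} (inj₂ (cong suc (sym (toℕ-inject₁ j))))
      ◅ pathToEnd k (inject₁ j) (trans (toℕ-inject₁ j) (suc-injective eq))

  toEnd : ∀ s v → side d≤n v ≡ s → Star (Adj L) v end
  toEnd s v eq = subst (λ w → Star (Adj L) w end)
    (trans (cong node (sym eq)) (node-side v)) (go s)
    where
    go : ∀ s → Star (Adj L) (node s) end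
    go (inj₁ i) = edge {inj₁ i} {inj₂ zero} refl ◅ ε
    go (inj₂ j) = pathToEnd (toℕ j) j refl

denominator≢0 : ∀ n d → d < n →
  NonZero (3 * (n ∸ d) * (d ^ 2 ∸ 1 + n) + d * (d ^ 2 ∸ 1))
denominator≢0 n d d<n = >-nonZero
  (≤-trans (*-mono-≤ (≤-trans (m<n⇒0<n∸m d<n) (m≤n*m (n ∸ d) 3))
      (≤-trans (≤-trans (s≤s z≤n) d<n) (m≤n+m n (d ^ 2 ∸ 1))))
    (m≤m+n _ (d * (d ^ 2 ∸ 1))))

{-# OPTIONS --safe #-}

-- The distance to a fixed node v is the only function that vanishes exactly
-- at v, changes by at most one along an edge, and at every other node drops by
-- one along some edge.  This identifies the distances in the lollipop: 1 inside
-- the clique, j + 1 from the clique to path node j, and |i − j| along the path.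
-- With a = n − d, the sum S over ordered pairs is then
-- a(a − 1) + a d(d + 1) + d(d² − 1)/3, so 3S is the stated denominator.

module Submission where

open import Defs
import Algebra.Properties.Semiring.Sum
open import Data.Fin using (Fin; zero; suc; toℕ; cast; inject₁; splitAt; join)
open import Data.Fin.Properties using
  (_≟_; cast-is-id; cast-involutive; toℕ-inject₁; toℕ-injective; splitAt-join; join-splitAt)
open import Data.List using ([]; _∷_; _++_; map; filter; allFin; cartesianProduct; tabulate)
open import Data.List.Properties using (map-++; map-∘; map-tabulate)
open import Data.Nat using
  (ℕ; zero; suc; _+_; _*_; _∸_; _^_; _≤_; _<_; z≤n; s≤s; ∣_-_∣; NonZero)
open import Data.Nat.ListAction using (sum)
open import Data.Nat.ListAction.Properties using (sum-++)
open import Data.Nat.Properties using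
  (<⇒≤; <-trans; ≤-refl; ≤-reflexive; ≤-trans; ≤-antisym; m≤n⇒m≤1+n; n≤1+n; 1+n≰n;
   +-identityʳ; +-assoc; +-cancelʳ-≡; m∸n+n≡m;
   ∣n-n∣≡0; ∣m-n∣≡0⇒m≡n; ∣-∣-triangle; ∣-∣-identityʳ; suc-injective; +-*-semiring)
open import Data.Nat.Tactic.RingSolver using (solve-∀)
open import Data.Integer using (ℤ; +_) renaming (_*_ to _*ᶻ_)
open import Data.Integer.Properties using (pos-*)
open import Data.Product using (∃; _×_; _,_; proj₁; proj₂; uncurry)
open import Data.Rational using (_/_)
open import Data.Rational.Unnormalised using (mkℚᵘ; *≡*)
open import Data.Rational.Properties using (fromℚᵘ-cong)
open import Data.Sum using (_⊎_; inj₁; inj₂)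
import Data.Sum as Sum
open import Data.Vec using (Vec; []; _∷_; head; last)
open import Data.Vec.Relation.Unary.All using (All; []; _∷_)
import Data.Vec.Relation.Unary.All as All
open import Data.Vec.Relation.Unary.AllPairs using ([]; _∷_)
open import Data.Vec.Relation.Unary.Linked using (Linked; [-]; _∷_)
open import Function using (_∘_; id)
open import Relation.Binary.PropositionalEquality using
  (_≡_; _≢_; refl; sym; trans; cong; cong₂; subst; module ≡-Reasoning)
open import Relation.Nullary using (yes; no; ¬_; ¬?; decidable-stable)
open import Relation.Unary using (Pred; Decidable)
open import Level using (0ℓ)

open Algebra.Properties.Semiring.Sum +-*-semiring using
  (sum-syntax; sum-cong-≗; ∑-distrib-+; ∑-comm)
open Graph
open ≡-Reasoning

-- Distances from potentials

module _ {n} (G : Graph n) (c : Connected G) (v : Fin n) (g : Fin n → ℕ)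
  (g-zero      : g v ≡ 0)
  (zero-unique : ∀ {u} → g u ≡ 0 → u ≡ v)
  (lipschitz   : ∀ {u w} → Adj G u w → g u ≤ suc (g w))
  (descent     : ∀ {u k} → g u ≡ suc k → ∃ λ w → Adj G u w × g w ≡ k)
  where

  -- Each edge lowers `g` by at most one, so the drop of `g` from head to last bounds the number of
  -- edges from below.
  linked-bound : ∀ {k} {ws : Vec (Fin n) (suc k)} → Linked (Adj G) ws →
                 g (head ws) ≤ k + g (last ws)
  linked-bound [-]      = ≤-refl
  linked-bound {ws = _ ∷ _ ∷ _} (a ∷ as) = ≤-trans (lipschitz a) (s≤s (linked-bound as))

  path-bound : ∀ {u k} → PathOfLength G u v k → g u ≤ k
  path-bound {u} {k} (_ , mkPath refl e l _) =
    subst (λ x → g u ≤ x)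
      (trans (cong (λ x → k + x) (trans (cong g e) g-zero)) (+-identityʳ k)) (linked-bound l)

  -- Follow `descent` until the potential is zero. The bound on all nodes strengthens the induction:
  -- the new head has potential `suc k`, the tail at most `k`, so no node repeats.
  descending-path : ∀ k {u} → g u ≡ k →
    ∃ λ (ws : Vec (Fin n) (suc k)) → IsPath G u v ws × All (λ w → g w ≤ k) ws
  descending-path zero {u} eq =
    u ∷ [] , mkPath refl (zero-unique eq) [-] ([] ∷ []) , ≤-reflexive eq ∷ []
  descending-path (suc k) {u} eq with descent eq
  ... | w , a , eq′ with descending-path k eq′
  ... | w ∷ ws , mkPath refl e l q , below =
    u ∷ w ∷ ws
    , mkPath refl e (a ∷ l)
        (All.map (λ { gx≤k refl → 1+n≰n (subst (_≤ k) eq gx≤k) }) below ∷ q)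
    , ≤-reflexive eq ∷ All.map m≤n⇒m≤1+n below

  -- Minimality against the descending path gives one inequality, `path-bound` on a shortest path
  -- the other.
  dist-unique : ∀ u → dist G c u v ≡ g u
  dist-unique u with shortest G c u v | descending-path (g u) refl
  ... | k , p , min | ws , q , _ = ≤-antisym (min (g u) (ws , q)) (path-bound p)

dist-refl : ∀ {n} (G : Graph n) (c : Connected G) u → dist G c u u ≡ 0
dist-refl G c u with shortest G c u u
... | zero  , _ , _ = refl
... | suc _ , _ , min with () ← min 0 (u ∷ [] , mkPath refl refl [-] ([] ∷ []))

-- Finite sums

sum-filter : ∀ {A : Set} {P : Pred A 0ℓ} (P? : Decidable P) (f : A → ℕ) →
  (∀ {x} → ¬ P x → f x ≡ 0) → ∀ xs → sum (map f (filter P? xs)) ≡ sum (map f xs)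
sum-filter P? f z [] = refl
sum-filter P? f z (x ∷ xs) with P? x
... | yes _  = cong (λ y → f x + y) (sum-filter P? f z xs)
... | no ¬px = trans (sum-filter P? f z xs) (cong (_+ sum (map f xs)) (sym (z ¬px)))

sum-cartesianProduct : ∀ {A B : Set} (f : A × B → ℕ) xs ys →
  sum (map f (cartesianProduct xs ys)) ≡ sum (map (λ x → sum (map (λ y → f (x , y)) ys)) xs)
sum-cartesianProduct f []       ys = refl
sum-cartesianProduct f (x ∷ xs) ys = begin
  sum (map f (map (x ,_) ys ++ cartesianProduct xs ys))
    ≡⟨ cong sum (map-++ f (map (x ,_) ys) _) ⟩
  sum (map f (map (x ,_) ys) ++ map f (cartesianProduct xs ys))
    ≡⟨ sum-++ (map f (map (x ,_) ys)) _ ⟩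
  sum (map f (map (x ,_) ys)) + sum (map f (cartesianProduct xs ys))
    ≡⟨ cong₂ _+_ (cong sum (sym (map-∘ ys))) (sum-cartesianProduct f xs ys) ⟩
  sum (map (λ y → f (x , y)) ys) + sum (map (λ x → sum (map (λ y → f (x , y)) ys)) xs) ∎

sum-tabulate : ∀ n (f : Fin n → ℕ) → sum (tabulate f) ≡ ∑[ i < n ] f i
sum-tabulate zero    f = refl
sum-tabulate (suc n) f = cong (λ y → f zero + y) (sum-tabulate n (f ∘ suc))

sum-allFin : ∀ n (f : Fin n → ℕ) → sum (map f (allFin n)) ≡ ∑[ i < n ] f i
sum-allFin n f = trans (cong sum (map-tabulate id f)) (sum-tabulate n f)

∑-const : ∀ n x → ∑[ _ < n ] x ≡ n * x
∑-const zero    x = refl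
∑-const (suc n) x = cong (λ y → x + y) (∑-const n x)

∑-splitAt : ∀ a d (f : Fin a ⊎ Fin d → ℕ) →
  ∑[ i < a + d ] f (splitAt a i) ≡ ∑[ i < a ] f (inj₁ i) + ∑[ j < d ] f (inj₂ j)
∑-splitAt zero    d f = refl
∑-splitAt (suc a) d f = trans
  -- On successors `splitAt (suc a)` is `splitAt a` followed by `suc` on the left summand, so the
  -- induction runs with `f` precomposed by that map.
  (cong (λ y → f (inj₁ zero) + y) (∑-splitAt a d (f ∘ Sum.map suc id)))
  (sym (+-assoc (f (inj₁ zero)) _ _))

∑-cast : ∀ {m n} (eq : m ≡ n) (f : Fin n → ℕ) → ∑[ i < m ] f (cast eq i) ≡ ∑[ i < n ] f i
∑-cast refl f = sum-cong-≗ (λ i → cong f (cast-is-id refl i))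

distanceSum-∑ : ∀ {n} (G : Graph n) (c : Connected G) →
  distanceSum G c ≡ ∑[ u < n ] ∑[ v < n ] dist G c u v
distanceSum-∑ {n} G c = begin
  distanceSum G c
    ≡⟨ sum-filter (λ (u , v) → ¬? (u ≟ v)) (uncurry (dist G c)) offDiagonal
         (cartesianProduct (allFin n) (allFin n)) ⟩
  sum (map (uncurry (dist G c)) (cartesianProduct (allFin n) (allFin n)))
    ≡⟨ sum-cartesianProduct _ (allFin n) (allFin n) ⟩
  sum (map (λ u → sum (map (dist G c u) (allFin n))) (allFin n))
    ≡⟨ sum-allFin n _ ⟩
  ∑[ u < n ] sum (map (dist G c u) (allFin n))
    ≡⟨ sum-cong-≗ (λ u → sum-allFin n (dist G c u)) ⟩
  ∑[ u < n ] ∑[ v < n ] dist G c u v ∎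
  where
  offDiagonal : ∀ {p} → ¬ (proj₁ p ≢ proj₂ p) → uncurry (dist G c) p ≡ 0
  -- Rejection by the filter gives only a double negation, which decidable equality removes.
  offDiagonal {u , v} ¬u≢v with refl ← decidable-stable (u ≟ v) ¬u≢v = dist-refl G c u

-- Distances in the lollipop

-- Recursion on both indices lets `completeSum (suc a)` unfold into its first row, its first column
-- and the same sum for `a`.
completeDist : ∀ {a} → Fin a → Fin a → ℕ
completeDist zero    zero    = 0
completeDist zero    (suc _) = 1
completeDist (suc _) zero    = 1
completeDist (suc i) (suc j) = completeDist i j

completeDist-refl : ∀ {a} (i : Fin a) → completeDist i i ≡ 0
completeDist-refl zero    = refl
completeDist-refl (suc i) = completeDist-refl i

completeDist≤1 : ∀ {a} (i j : Fin a) → completeDist i j ≤ 1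
completeDist≤1 zero    zero    = z≤n
completeDist≤1 zero    (suc _) = ≤-refl
completeDist≤1 (suc _) zero    = ≤-refl
completeDist≤1 (suc i) (suc j) = completeDist≤1 i j

completeDist≡0 : ∀ {a} (i j : Fin a) → completeDist i j ≡ 0 → i ≡ j
completeDist≡0 zero    zero    _  = refl
completeDist≡0 (suc i) (suc j) eq = cong suc (completeDist≡0 i j eq)

-- Move one node towards `j`: up from node 0, down if `j` is 0. Otherwise lower both indices by one,
-- which preserves differences and adjacency.
path-descent : ∀ {d} (i j : Fin d) {k} → ∣ toℕ i - toℕ j ∣ ≡ suc k →
  ∃ λ r → Adj (path d) i r × ∣ toℕ r - toℕ j ∣ ≡ k
path-descent zero    (suc {suc _} j) eq = suc zero , inj₁ refl , suc-injective eq
path-descent (suc i) zero    eq =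
  inject₁ i , inj₂ (cong suc (sym (toℕ-inject₁ i)))
  , trans (∣-∣-identityʳ _) (trans (toℕ-inject₁ i) (suc-injective eq))
path-descent (suc i) (suc j) eq with path-descent i j eq
... | r , a , eq′ = suc r , Sum.map (cong suc) (cong suc) a , eq′

path-adj-dist : ∀ {d} {i j : Fin d} → Adj (path d) i j → ∣ toℕ i - toℕ j ∣ ≡ 1
path-adj-dist {i = i} {j} (inj₁ p) rewrite p = ∣n-1+n∣≡1 (toℕ i)
  where
  ∣n-1+n∣≡1 : ∀ n → ∣ n - suc n ∣ ≡ 1
  ∣n-1+n∣≡1 zero    = refl
  ∣n-1+n∣≡1 (suc n) = ∣n-1+n∣≡1 n
path-adj-dist {i = i} {j} (inj₂ p) rewrite p = ∣1+n-n∣≡1 (toℕ j)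
  where
  ∣1+n-n∣≡1 : ∀ n → ∣ suc n - n ∣ ≡ 1
  ∣1+n-n∣≡1 zero    = refl
  ∣1+n-n∣≡1 (suc n) = ∣1+n-n∣≡1 n

-- Defined on the disjoint sum, so that its clauses line up with those of `JoinAdj`.
lollipopDist : ∀ {a d} → Fin a ⊎ Fin d → Fin a ⊎ Fin d → ℕ
lollipopDist (inj₁ i) (inj₁ j) = completeDist i j
lollipopDist (inj₁ _) (inj₂ j) = suc (toℕ j)
lollipopDist (inj₂ i) (inj₁ _) = suc (toℕ i)
lollipopDist (inj₂ i) (inj₂ j) = ∣ toℕ i - toℕ j ∣

module _ {a d : ℕ} where
  open Lollipop a d

  lollipopDist-refl : ∀ s → lollipopDist {a} {d} s s ≡ 0
  lollipopDist-refl (inj₁ i) = completeDist-refl i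
  lollipopDist-refl (inj₂ i) = ∣n-n∣≡0 (toℕ i)

  lollipopDist≡0 : ∀ s t → lollipopDist {a} {d} s t ≡ 0 → s ≡ t
  lollipopDist≡0 (inj₁ i) (inj₁ j) eq = cong inj₁ (completeDist≡0 i j eq)
  lollipopDist≡0 (inj₂ i) (inj₂ j) eq = cong inj₂ (toℕ-injective (∣m-n∣≡0⇒m≡n eq))

  -- Clique and path meet only at path node 0, and rewriting by that equation settles the crossings.
  -- Within the path it is the triangle inequality with a first leg of length one.
  lollipopDist-lipschitz : ∀ s r t → JoinAdj s r → lollipopDist s t ≤ suc (lollipopDist r t)
  lollipopDist-lipschitz (inj₁ i) (inj₁ _) (inj₁ k) _ = ≤-trans (completeDist≤1 i k) (s≤s z≤n)
  lollipopDist-lipschitz (inj₁ _) (inj₁ _) (inj₂ _) _ = n≤1+n _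
  lollipopDist-lipschitz (inj₁ i) (inj₂ _) (inj₁ k) _ = ≤-trans (completeDist≤1 i k) (s≤s z≤n)
  lollipopDist-lipschitz (inj₁ _) (inj₂ _) (inj₂ _) p rewrite p = ≤-refl
  lollipopDist-lipschitz (inj₂ _) (inj₁ _) (inj₁ _) p rewrite p = s≤s z≤n
  lollipopDist-lipschitz (inj₂ _) (inj₁ _) (inj₂ _) p rewrite p = m≤n⇒m≤1+n (n≤1+n _)
  lollipopDist-lipschitz (inj₂ i) (inj₂ j) (inj₁ _) (inj₁ p) rewrite p = s≤s (m≤n⇒m≤1+n (n≤1+n _))
  lollipopDist-lipschitz (inj₂ i) (inj₂ j) (inj₁ _) (inj₂ p) rewrite p = ≤-refl
  lollipopDist-lipschitz (inj₂ i) (inj₂ j) (inj₂ k) p = ≤-trans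
    (∣-∣-triangle (toℕ i) (toℕ j) (toℕ k))
    (≤-reflexive (cong (_+ ∣ toℕ j - toℕ k ∣) (path-adj-dist p)))

  lollipopDist-descent : ∀ s t {k} → lollipopDist s t ≡ suc k →
    ∃ λ r → JoinAdj s r × lollipopDist r t ≡ k
  lollipopDist-descent (inj₁ i) (inj₁ j) {k} eq =
    inj₁ j , i≢j , trans (completeDist-refl j) (0≡k eq (completeDist≤1 i j))
    where
    i≢j : i ≢ j
    i≢j refl with () ← trans (sym (completeDist-refl i)) eq
    0≡k : ∀ {m} → m ≡ suc k → m ≤ 1 → 0 ≡ k
    0≡k refl (s≤s z≤n) = refl
  -- The split on `j` shows that the path is nonempty, so that its node 0, the entry from the
  -- clique, can be named.
  lollipopDist-descent (inj₁ _) (inj₂ j@zero)    refl = inj₂ zero , refl , refl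
  lollipopDist-descent (inj₁ _) (inj₂ j@(suc _)) refl = inj₂ zero , refl , refl
  lollipopDist-descent (inj₂ zero)    (inj₁ j) refl = inj₁ j , refl , completeDist-refl j
  lollipopDist-descent (inj₂ (suc i)) (inj₁ _) refl =
    inj₂ (inject₁ i) , inj₂ (cong suc (sym (toℕ-inject₁ i))) , cong suc (toℕ-inject₁ i)
  lollipopDist-descent (inj₂ i) (inj₂ j) eq with path-descent i j eq
  ... | r , a , eq′ = inj₂ r , a , eq′

module _ {n d} (d≤n : d ≤ n) where

  -- Descent is proved on the disjoint sum; surjectivity turns its witness back into a node, while
  -- `side-injective` makes the zero of the potential unique.
  side-surjective : ∀ s → ∃ λ v → side d≤n v ≡ s
  side-surjective s = cast (m∸n+n≡m d≤n) (join (n ∸ d) d s) , trans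
    (cong (splitAt (n ∸ d)) (cast-involutive (sym (m∸n+n≡m d≤n)) (m∸n+n≡m d≤n) (join (n ∸ d) d s)))
    (splitAt-join (n ∸ d) d s)

  side-injective : ∀ {u v} → side d≤n u ≡ side d≤n v → u ≡ v
  side-injective {u} {v} eq = begin
    u                                     ≡⟨ node-side u ⟨
    cast _ (join (n ∸ d) d (side d≤n u))  ≡⟨ cong (cast (m∸n+n≡m d≤n) ∘ join (n ∸ d) d) eq ⟩
    cast _ (join (n ∸ d) d (side d≤n v))  ≡⟨ node-side v ⟩
    v                                     ∎
    where
    node-side : ∀ v → cast (m∸n+n≡m d≤n) (join (n ∸ d) d (side d≤n v)) ≡ v
    node-side v = trans
      (cong (cast (m∸n+n≡m d≤n)) (join-splitAt (n ∸ d) d (cast (sym (m∸n+n≡m d≤n)) v)))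
      (cast-involutive (m∸n+n≡m d≤n) (sym (m∸n+n≡m d≤n)) v)

  dist-lollipop : ∀ (c : Connected (lollipop n d d≤n)) u v →
    dist (lollipop n d d≤n) c u v ≡ lollipopDist (side d≤n u) (side d≤n v)
  dist-lollipop c u v = dist-unique (lollipop n d d≤n) c v
    (λ w → lollipopDist (side d≤n w) (side d≤n v))
    (lollipopDist-refl (side d≤n v))
    (λ eq → side-injective (lollipopDist≡0 _ _ eq))
    (λ {u} {w} → lollipopDist-lipschitz (side d≤n u) (side d≤n w) (side d≤n v))
    descent
    u
    where
    descent : ∀ {u k} → lollipopDist (side d≤n u) (side d≤n v) ≡ suc k →
      ∃ λ w → Lollipop.JoinAdj (n ∸ d) d (side d≤n u) (side d≤n w)
            × lollipopDist (side d≤n w) (side d≤n v) ≡ k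
    descent {u} eq with lollipopDist-descent (side d≤n u) (side d≤n v) eq
    ... | r , a , eq′ with side-surjective r
    ... | w , refl = w , a , eq′

  ∑-side : ∀ (f : Fin (n ∸ d) ⊎ Fin d → ℕ) →
    ∑[ v < n ] f (side d≤n v) ≡ ∑[ i < n ∸ d ] f (inj₁ i) + ∑[ j < d ] f (inj₂ j)
  ∑-side f = trans (∑-cast (sym (m∸n+n≡m d≤n)) (f ∘ splitAt (n ∸ d))) (∑-splitAt (n ∸ d) d f)

-- Distance sums

-- `triangular d` is the total distance from one clique node to the path, and also the first row of
-- the distance matrix of a path with `suc d` nodes.
completeSum pathSum triangular : ℕ → ℕ
completeSum a = ∑[ i < a ] ∑[ j < a ] completeDist i j
pathSum     d = ∑[ i < d ] ∑[ j < d ] ∣ toℕ i - toℕ j ∣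
triangular  d = ∑[ j < d ] suc (toℕ j)

-- Adding `a` on the left avoids the subtraction in a(a - 1). The induction step adds a row and a
-- column of `a` ones each.
completeSum-closed : ∀ a → completeSum a + a ≡ a * a
completeSum-closed zero    = refl
completeSum-closed (suc a) = begin
  ∑[ j < a ] 1 + (∑[ i < a ] (1 + ∑[ j < a ] completeDist i j)) + suc a
    ≡⟨ cong (λ x → ∑[ j < a ] 1 + x + suc a)
         (∑-distrib-+ (λ _ → 1) (λ i → ∑[ j < a ] completeDist i j)) ⟩
  ∑[ j < a ] 1 + (∑[ j < a ] 1 + completeSum a) + suc a
    ≡⟨ cong (λ x → x + (x + completeSum a) + suc a) (∑-const a 1) ⟩
  a * 1 + (a * 1 + completeSum a) + suc a
    ≡⟨ regroup a (completeSum a) ⟩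
  suc (a + a + (completeSum a + a))
    ≡⟨ cong (λ x → suc (a + a + x)) (completeSum-closed a) ⟩
  suc (a + a + a * a)
    ≡⟨ square a ⟩
  suc a * suc a ∎
  where
  regroup : ∀ a x → a * 1 + (a * 1 + x) + suc a ≡ suc (a + a + (x + a))
  regroup = solve-∀
  square : ∀ a → suc (a + a + a * a) ≡ suc a * suc a
  square = solve-∀

-- The sum peels off its first term, not its last; each of the `d` remaining terms is then one
-- larger than its counterpart in `triangular d`.
triangular-suc : ∀ d → triangular (suc d) ≡ d + suc (triangular d)
triangular-suc d = begin
  1 + ∑[ j < d ] (1 + suc (toℕ j))   ≡⟨ cong suc (∑-distrib-+ {d} (λ _ → 1) (suc ∘ toℕ)) ⟩
  1 + (∑[ j < d ] 1 + triangular d)  ≡⟨ cong (λ x → 1 + (x + triangular d)) (∑-const d 1) ⟩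
  1 + (d * 1 + triangular d)         ≡⟨ regroup d (triangular d) ⟩
  d + suc (triangular d)             ∎
  where
  regroup : ∀ d t → 1 + (d * 1 + t) ≡ d + suc t
  regroup = solve-∀

triangular-closed : ∀ d → 2 * triangular d ≡ d * suc d
triangular-closed zero    = refl
triangular-closed (suc d) = begin
  2 * triangular (suc d)        ≡⟨ cong (2 *_) (triangular-suc d) ⟩
  2 * (d + suc (triangular d))  ≡⟨ regroup d (triangular d) ⟩
  2 * triangular d + 2 * suc d  ≡⟨ cong (_+ 2 * suc d) (triangular-closed d) ⟩
  d * suc d + 2 * suc d         ≡⟨ factor d ⟩
  suc d * suc (suc d)           ∎
  where
  regroup : ∀ d t → 2 * (d + suc t) ≡ 2 * t + 2 * suc d
  regroup = solve-∀
  factor : ∀ d → d * suc d + 2 * suc d ≡ suc d * suc (suc d)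
  factor = solve-∀

-- The form avoids both division and subtraction in d(d² - 1)/3. Path node 0 contributes a row and a
-- column of sum `triangular d`; the other entries depend only on index differences and form
-- `pathSum d`.
pathSum-closed : ∀ d → 3 * pathSum d + d ≡ d * d * d
pathSum-closed zero    = refl
pathSum-closed (suc d) = begin
  3 * (triangular d + (∑[ i < d ] (suc (toℕ i) + ∑[ j < d ] ∣ toℕ i - toℕ j ∣))) + suc d
    ≡⟨ cong (λ x → 3 * (triangular d + x) + suc d)
         (∑-distrib-+ {d} (suc ∘ toℕ) (λ i → ∑[ j < d ] ∣ toℕ i - toℕ j ∣)) ⟩
  3 * (triangular d + (triangular d + pathSum d)) + suc d
    ≡⟨ regroup d (triangular d) (pathSum d) ⟩
  3 * (2 * triangular d) + (3 * pathSum d + d) + 1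
    ≡⟨ cong₂ (λ x y → 3 * x + y + 1) (triangular-closed d) (pathSum-closed d) ⟩
  3 * (d * suc d) + d * d * d + 1
    ≡⟨ cube d ⟩
  suc d * suc d * suc d ∎
  where
  regroup : ∀ d t p → 3 * (t + (t + p)) + suc d ≡ 3 * (2 * t) + (3 * p + d) + 1
  regroup = solve-∀
  cube : ∀ d → 3 * (d * suc d) + d * d * d + 1 ≡ suc d * suc d * suc d
  cube = solve-∀

-- Splitting rows and columns by side gives four blocks. The two mixed blocks are transposes of each
-- other, so exchanging the sums in one shows that each contributes `a * triangular d`.
distanceSum-lollipop : ∀ n d (d≤n : d ≤ n) (c : Connected (lollipop n d d≤n)) →
  distanceSum (lollipop n d d≤n) c
    ≡ completeSum (n ∸ d) + (n ∸ d) * (2 * triangular d) + pathSum d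
distanceSum-lollipop n d d≤n c = begin
  distanceSum (lollipop n d d≤n) c
    ≡⟨ distanceSum-∑ (lollipop n d d≤n) c ⟩
  ∑[ u < n ] ∑[ v < n ] dist (lollipop n d d≤n) c u v
    ≡⟨ sum-cong-≗ (λ u → trans (sum-cong-≗ (dist-lollipop d≤n c u))
         (∑-side d≤n (lollipopDist (side d≤n u)))) ⟩
  ∑[ u < n ] row (side d≤n u)
    ≡⟨ ∑-side d≤n row ⟩
  ∑[ i < a ] (∑[ j < a ] completeDist i j + triangular d)
    + ∑[ i < d ] (∑[ _ < a ] suc (toℕ i) + ∑[ j < d ] ∣ toℕ i - toℕ j ∣)
    ≡⟨ cong₂ _+_ (∑-distrib-+ {a} _ _) (∑-distrib-+ {d} _ _) ⟩
  completeSum a + (∑[ _ < a ] triangular d)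
    + ((∑[ i < d ] ∑[ _ < a ] suc (toℕ i)) + pathSum d)
    ≡⟨ cong₂ (λ x y → completeSum a + x + (y + pathSum d)) (∑-const a (triangular d))
         (trans (∑-comm {d} {a} (λ i _ → suc (toℕ i))) (∑-const a (triangular d))) ⟩
  completeSum a + a * triangular d + (a * triangular d + pathSum d)
    ≡⟨ regroup a (completeSum a) (triangular d) (pathSum d) ⟩
  completeSum a + a * (2 * triangular d) + pathSum d ∎
  where
  a = n ∸ d
  row : Fin a ⊎ Fin d → ℕ
  row s = (∑[ i < a ] lollipopDist s (inj₁ i)) + (∑[ j < d ] lollipopDist s (inj₂ j))
  regroup : ∀ a k t p → k + a * t + (a * t + p) ≡ k + a * (2 * t) + p
  regroup = solve-∀

3*distanceSum-lollipop : ∀ n d (0<d : 0 < d) (d≤n : d ≤ n) (c : Connected (lollipop n d d≤n)) →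
  3 * distanceSum (lollipop n d d≤n) c
    ≡ 3 * (n ∸ d) * (d ^ 2 ∸ 1 + n) + d * (d ^ 2 ∸ 1)
-- The added `3 * a + d` supplies the summands that the closed forms for clique and path carry on
-- their left-hand sides.
3*distanceSum-lollipop n d@(suc e) _ d≤n c = +-cancelʳ-≡ (3 * a + d) _ _ (begin
  3 * distanceSum (lollipop n d d≤n) c + (3 * a + d)
    ≡⟨ cong (λ s → 3 * s + (3 * a + d)) (distanceSum-lollipop n d d≤n c) ⟩
  3 * (completeSum a + a * (2 * triangular d) + pathSum d) + (3 * a + d)
    ≡⟨ regroup a d (completeSum a) (2 * triangular d) (pathSum d) ⟩
  3 * (completeSum a + a) + 3 * (a * (2 * triangular d)) + (3 * pathSum d + d)
    ≡⟨ cong₂ _+_ (cong₂ (λ x y → 3 * x + 3 * (a * y)) (completeSum-closed a) (triangular-closed d))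
         (pathSum-closed d) ⟩
  3 * (a * a) + 3 * (a * (d * suc d)) + d * d * d
    -- Since `d` is `suc e`, the term `d ^ 2 ∸ 1` computes to `e * 1 + e * (suc e * 1)` without
    -- truncation; at `d = 0` it would be 0 instead of -1.
    ≡⟨ expand a e ⟩
  3 * a * (e * 1 + e * (suc e * 1) + (a + d)) + d * (e * 1 + e * (suc e * 1)) + (3 * a + d)
    ≡⟨ cong (λ m → 3 * a * (d ^ 2 ∸ 1 + m) + d * (d ^ 2 ∸ 1) + (3 * a + d)) (m∸n+n≡m d≤n) ⟩
  3 * a * (d ^ 2 ∸ 1 + n) + d * (d ^ 2 ∸ 1) + (3 * a + d) ∎)
  where
  a = n ∸ d
  regroup : ∀ a d k t p → 3 * (k + a * t + p) + (3 * a + d) ≡ 3 * (k + a) + 3 * (a * t) + (3 * p + d)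
  regroup = solve-∀
  expand : ∀ a e → 3 * (a * a) + 3 * (a * (suc e * suc (suc e))) + suc e * suc e * suc e
    ≡ 3 * a * (e * 1 + e * (suc e * 1) + (a + suc e)) + suc e * (e * 1 + e * (suc e * 1)) + (3 * a + suc e)
  expand = solve-∀

-- Agglomeration as a quotient

-- Cross-multiplication is equality of unnormalised rationals, and normalising respects it. `mkℚᵘ`
-- stores the predecessor of the denominator, hence the match on `suc`.
/-≃ : ∀ {p q : ℤ} {m n} .{{_ : NonZero m}} .{{_ : NonZero n}} →
  p *ᶻ + n ≡ q *ᶻ + m → p / m ≡ q / n
/-≃ {p} {q} {suc m} {suc n} eq = fromℚᵘ-cong {mkℚᵘ p m} {mkℚᵘ q n} (*≡* eq)

lemma2p4p1 : (n d : ℕ) (1<d : 1 < d) (d<n : d < n) →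
    agglomeration (lollipop n d (<⇒≤ d<n)) (lollipop-connected n d 1<d (<⇒≤ d<n)) (<-trans 1<d d<n)
    ≡ _/_ (+ (3 * (n ∸ 1))) (3 * (n ∸ d) * (d ^ 2 ∸ 1 + n) + d * (d ^ 2 ∸ 1)) {{denominator≢0 n d d<n}}
lemma2p4p1 n d 1<d d<n = /-≃ {+ (n ∸ 1)} {+ (3 * (n ∸ 1))}
  {{distanceSum≢0 G c 2≤n}} {{denominator≢0 n d d<n}} (begin
  -- Cross-multiplied, the claim reduces to `D` being three times the distance sum.
  + (n ∸ 1) *ᶻ + D                     ≡⟨ pos-* (n ∸ 1) D ⟨
  + ((n ∸ 1) * D)                      ≡⟨ cong (λ x → + ((n ∸ 1) * x)) (3*distanceSum-lollipop n d (<⇒≤ 1<d) (<⇒≤ d<n) c) ⟨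
  + ((n ∸ 1) * (3 * distanceSum G c))  ≡⟨ cong +_ (regroup (n ∸ 1) (distanceSum G c)) ⟩
  + (3 * (n ∸ 1) * distanceSum G c)    ≡⟨ pos-* (3 * (n ∸ 1)) (distanceSum G c) ⟩
  + (3 * (n ∸ 1)) *ᶻ + distanceSum G c ∎)
  where
  G = lollipop n d (<⇒≤ d<n)
  c = lollipop-connected n d 1<d (<⇒≤ d<n)
  2≤n = <-trans 1<d d<n
  D = 3 * (n ∸ d) * (d ^ 2 ∸ 1 + n) + d * (d ^ 2 ∸ 1)
  regroup : ∀ m s → m * (3 * s) ≡ 3 * m * s
  regroup = solve-∀
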